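{- A consecution $\Gamma\vdash\phi$ is derivable in $\mathsf{G_{BDFNL}}$ if and only if $\mathbb{BDRG}\models\Gamma\vdash\phi$.
   Context: $\mathcal{L}_{\mathrm{LC}}$-formulas are built from propositional variables and $\top,\bot$ using $\wedge,\vee,\to,\bullet,\leftarrow$. Structures: $\Gamma::=\phi\mid(\Gamma\odot\Gamma)\mid(\Gamma\barwedge\Gamma)$ with $\phi$ an $\mathcal{L}_{\mathrm{LC}}$-formula. A consecution is $\Gamma\vdash\phi$ with $\Gamma$ a structure and $\phi$ an $\mathcal{L}_{\mathrm{LC}}$-formula. A context $\Gamma[-]$ is a structure with a hole, and $\Gamma[\Delta]$ is the result of filling the hole with the structure $\Delta$. The formula $\tau(\Gamma)$ is defined by $\tau(\phi)=\phi$, $\tau(\Gamma\odot\Delta)=\tau(\Gamma)\bullet\tau(\Delta)$, $\tau(\Gamma\barwedge\Delta)=\tau(\Gamma)\wedge\tau(\Delta)$. $\mathsf{G_{BDFNL}}$ has: Axioms: $\phi\vdash\phi$; $\Gamma\vdash\top$; $\Gamma[\bot]\vdash\phi$. Logical rules: from $\Delta\vdash\phi$ and $\Gamma[\psi]\vdash\gamma$ infer $\Gamma[\Delta\odot(\phi\to\psi)]\vdash\gamma$; from $\phi\odot\Gamma\vdash\psi$ infer $\Gamma\vdash\phi\to\psi$; from $\Gamma[\phi]\vdash\gamma$ and $\Delta\vdash\psi$ infer $\Gamma[(\phi\leftarrow\psi)\odot\Delta]\vdash\gamma$; from $\Gamma\odot\psi\vdash\phi$ infer $\Gamma\vdash\phi\leftarrow\psi$;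 from $\Gamma[\phi\odot\psi]\vdash\gamma$ infer $\Gamma[\phi\bullet\psi]\vdash\gamma$; from $\Gamma\vdash\phi$ and $\Delta\vdash\psi$ infer $\Gamma\odot\Delta\vdash\phi\bullet\psi$; from $\Gamma[\phi\barwedge\psi]\vdash\gamma$ infer $\Gamma[\phi\wedge\psi]\vdash\gamma$; from $\Gamma\vdash\phi$ and $\Delta\vdash\psi$ infer $\Gamma\barwedge\Delta\vdash\phi\wedge\psi$; from $\Gamma[\phi]\vdash\gamma$ and $\Gamma[\psi]\vdash\gamma$ infer $\Gamma[\phi\vee\psi]\vdash\gamma$; from $\Gamma\vdash\phi_i$ infer $\Gamma\vdash\phi_1\vee\phi_2$ ($i=1,2$). Structural rules: from $\Gamma[\Delta\barwedge\Delta]\vdash\phi$ infer $\Gamma[\Delta]\vdash\phi$; from $\Gamma[\Delta]\vdash\phi$ infer $\Gamma[\Sigma\barwedge\Delta]\vdash\phi$; from $\Gamma[\Delta\barwedge\Lambda]\vdash\phi$ infer $\Gamma[\Lambda\barwedge\Delta]\vdash\phi$; from $\Gamma[(\Delta_1\barwedge\Delta_2)\barwedge\Delta_3]\vdash\phi$ infer $\Gamma[\Delta_1\barwedge(\Delta_2\barwedge\Delta_3)]\vdash\phi$. A bounded distributive lattice-ordered residuated groupoid (BDRG) is an algebra $(A,\wedge,\vee,\top,\bot,\to,\bullet,\leftarrow)$ such that $(A,\wedge,\vee,\top,\bot)$ is a bounded distributive lattice and, for all $a,b,c\in A$: $a\bullet b\le c$ iff $b\le a\to c$ iff $a\le c\leftarrow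 b$. $\mathbb{BDRG}$ is the class of all BDRGs. $\mathbb{BDRG}\models\Gamma\vdash\phi$ means that $\mu(\tau(\Gamma))\le\mu(\phi)$ for every BDRG $\mathfrak{A}$ and every assignment $\mu$ in $\mathfrak{A}$ (extended homomorphically to formulas). -}

module Defs where

open import Algebra.Core using (Op₂)
open import Function.Bundles using (_⇔_)
open import Level using (Level; _⊔_; suc)
open import Relation.Binary.Core using (Rel)
open import Relation.Binary.Definitions using (Maximum; Minimum)
open import Relation.Binary.Lattice.Structures using (IsDistributiveLattice)

-- Equality of elements is the setoid equality _≈_, which is _≤_ in both
-- directions.  Residuation makes _•_ monotone in both arguments, _⇒_ and _⇐_
-- antitone in the denominator and monotone in the numerator, so these
-- operations respect _≈_ without further axioms.

record BDRG c ℓ₁ ℓ₂ : Set (suc (c ⊔ ℓ₁ ⊔ ℓ₂)) where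
  infix  4 _≈_ _≤_
  infixr 5 _⇒_
  infixl 5 _⇐_
  infixr 6 _∨_
  infixr 7 _∧_
  infixl 8 _•_
  field
    Carrier : Set c
    _≈_     : Rel Carrier ℓ₁
    _≤_     : Rel Carrier ℓ₂
    _∧_     : Op₂ Carrier
    _∨_     : Op₂ Carrier
    ⊤       : Carrier
    ⊥       : Carrier
    _⇒_     : Op₂ Carrier
    _•_     : Op₂ Carrier
    _⇐_     : Op₂ Carrier
    isDistributiveLattice : IsDistributiveLattice _≈_ _≤_ _∨_ _∧_
    maximum   : Maximum _≤_ ⊤
    minimum   : Minimum _≤_ ⊥
    residualʳ : ∀ a b c → (a • b ≤ c) ⇔ (b ≤ a ⇒ c)
    residualˡ : ∀ a b c → (a • b ≤ c) ⇔ (a ≤ c ⇐ b)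

  open IsDistributiveLattice isDistributiveLattice public

infixr 5 _⇒_
infixl 5 _⇐_
infixr 6 _∨_
infixr 7 _∧_
infixl 8 _•_

data Formula (Var : Set) : Set where
  var                 : Var → Formula Var
  ⊤ ⊥                 : Formula Var
  _∧_ _∨_ _⇒_ _•_ _⇐_ : Formula Var → Formula Var → Formula Var

infixl 7 _⊼_
infixl 8 _⊙_

data Structure (Var : Set) : Set where
  ⟨_⟩     : Formula Var → Structure Var
  _⊙_ _⊼_ : Structure Var → Structure Var → Structure Var

data Context (Var : Set) : Set where
  □         : Context Var
  _⊙ˡ_ _⊼ˡ_ : Context Var → Structure Var → Context Var
  _⊙ʳ_ _⊼ʳ_ : Structure Var → Context Var → Context Var

private variable
  Var                : Set
  φ ψ γ              : Formula Var
  Γ Δ Σ Λ Δ₁ Δ₂ Δ₃   : Structure Var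

infix 9 _[_]

_[_] : Context Var → Structure Var → Structure Var
□        [ Δ ] = Δ
(C ⊙ˡ Γ) [ Δ ] = C [ Δ ] ⊙ Γ
(C ⊼ˡ Γ) [ Δ ] = C [ Δ ] ⊼ Γ
(Γ ⊙ʳ C) [ Δ ] = Γ ⊙ C [ Δ ]
(Γ ⊼ʳ C) [ Δ ] = Γ ⊼ C [ Δ ]

τ : Structure Var → Formula Var
τ ⟨ φ ⟩   = φ
τ (Γ ⊙ Δ) = τ Γ • τ Δ
τ (Γ ⊼ Δ) = τ Γ ∧ τ Δ

infix 4 _⊢_

-- Derivability in the sequent calculus G_BDFNL (there is no cut rule).

data _⊢_ {Var : Set} : Structure Var → Formula Var → Set where
  id  : ⟨ φ ⟩ ⊢ φ
  ⊤R  : Γ ⊢ ⊤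
  ⊥L  : ∀ C → C [ ⟨ ⊥ ⟩ ] ⊢ φ

  ⇒L  : ∀ C → Δ ⊢ φ → C [ ⟨ ψ ⟩ ] ⊢ γ → C [ Δ ⊙ ⟨ φ ⇒ ψ ⟩ ] ⊢ γ
  ⇒R  : ⟨ φ ⟩ ⊙ Γ ⊢ ψ → Γ ⊢ φ ⇒ ψ
  ⇐L  : ∀ C → C [ ⟨ φ ⟩ ] ⊢ γ → Δ ⊢ ψ → C [ ⟨ φ ⇐ ψ ⟩ ⊙ Δ ] ⊢ γ
  ⇐R  : Γ ⊙ ⟨ ψ ⟩ ⊢ φ → Γ ⊢ φ ⇐ ψ
  •L  : ∀ C → C [ ⟨ φ ⟩ ⊙ ⟨ ψ ⟩ ] ⊢ γ → C [ ⟨ φ • ψ ⟩ ] ⊢ γ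
  •R  : Γ ⊢ φ → Δ ⊢ ψ → Γ ⊙ Δ ⊢ φ • ψ
  ∧L  : ∀ C → C [ ⟨ φ ⟩ ⊼ ⟨ ψ ⟩ ] ⊢ γ → C [ ⟨ φ ∧ ψ ⟩ ] ⊢ γ
  ∧R  : Γ ⊢ φ → Δ ⊢ ψ → Γ ⊼ Δ ⊢ φ ∧ ψ
  ∨L  : ∀ C → C [ ⟨ φ ⟩ ] ⊢ γ → C [ ⟨ ψ ⟩ ] ⊢ γ → C [ ⟨ φ ∨ ψ ⟩ ] ⊢ γ
  ∨R₁ : Γ ⊢ φ → Γ ⊢ φ ∨ ψ
  ∨R₂ : Γ ⊢ ψ → Γ ⊢ φ ∨ ψ

  contraction   : ∀ C → C [ Δ ⊼ Δ ] ⊢ φ → C [ Δ ] ⊢ φ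
  weakening     : ∀ C → C [ Δ ] ⊢ φ → C [ Σ ⊼ Δ ] ⊢ φ
  exchange      : ∀ C → C [ Δ ⊼ Λ ] ⊢ φ → C [ Λ ⊼ Δ ] ⊢ φ
  associativity : ∀ C → C [ (Δ₁ ⊼ Δ₂) ⊼ Δ₃ ] ⊢ φ → C [ Δ₁ ⊼ (Δ₂ ⊼ Δ₃) ] ⊢ φ

module _ {c ℓ₁ ℓ₂} (𝔄 : BDRG c ℓ₁ ℓ₂) where
  private module A = BDRG 𝔄

  ⟦_⟧ : Formula Var → (Var → A.Carrier) → A.Carrier
  ⟦ var p ⟧ μ = μ p
  ⟦ ⊤ ⟧     μ = A.⊤
  ⟦ ⊥ ⟧     μ = A.⊥
  ⟦ φ ∧ ψ ⟧ μ = ⟦ φ ⟧ μ A.∧ ⟦ ψ ⟧ μ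
  ⟦ φ ∨ ψ ⟧ μ = ⟦ φ ⟧ μ A.∨ ⟦ ψ ⟧ μ
  ⟦ φ ⇒ ψ ⟧ μ = ⟦ φ ⟧ μ A.⇒ ⟦ ψ ⟧ μ
  ⟦ φ • ψ ⟧ μ = ⟦ φ ⟧ μ A.• ⟦ ψ ⟧ μ
  ⟦ φ ⇐ ψ ⟧ μ = ⟦ φ ⟧ μ A.⇐ ⟦ ψ ⟧ μ

  Satisfies : (Var → A.Carrier) → Structure Var → Formula Var → Set ℓ₂
  Satisfies μ Γ φ = ⟦ τ Γ ⟧ μ A.≤ ⟦ φ ⟧ μ

-- Validity in all BDRGs of the given universe levels.

BDRG⊨ : ∀ c ℓ₁ ℓ₂ → Structure Var → Formula Var → Set (suc (c ⊔ ℓ₁ ⊔ ℓ₂))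
BDRG⊨ {Var} c ℓ₁ ℓ₂ Γ φ =
  (𝔄 : BDRG c ℓ₁ ℓ₂) (μ : Var → BDRG.Carrier 𝔄) → Satisfies 𝔄 μ Γ φ

{-# OPTIONS --safe #-}
module Submission where

-- Soundness is an induction on derivations.  Every operation that builds
-- structures is monotone and preserves ⊥ and binary joins in each argument, •
-- by residuation and ∧ by distributivity and leastness of ⊥; hence so does every
-- context.  Preservation gives the left rules for ⊥ and ∨; the other left rules
-- and the structural rules only replace, inside a context, an element by a
-- smaller one.
--
-- Completeness is a semantic cut elimination.  Call a set P of structures
-- closed if it contains every Γ such that, for all C and γ, the derivability of
-- C [ Δ ] ⊢ γ for all Δ in P implies that of C [ Γ ] ⊢ γ.  Closed sets form a
-- BDRG: meets are intersections, joins and products are closures of unions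
-- and of ⊙-products.  Distributivity comes from weakening, exchange and
-- contraction, by which, for closed P and Q, Γ ⊼ Δ lies in P ∩ Q when Γ ∈ P and
-- Δ ∈ Q, and Γ lies in P as soon as Γ ⊼ Γ does.  Interpreting a variable p by the set
-- of Γ with Γ ⊢ p, each formula φ receives a closed set Ext φ, and the truth
-- lemma states that ⟨ φ ⟩ ∈ Ext φ and that every Γ ∈ Ext φ satisfies Γ ⊢ φ.  Since
-- moreover Γ ∈ Ext (τ Γ), validity of Γ ⊢ φ in this algebra gives Γ ∈ Ext φ and
-- hence a derivation of Γ ⊢ φ without any appeal to cut.
--
-- The sets of structures live one universe too high to be the carrier of an
-- algebra at level zero.  The carrier is therefore the set of formulas,
-- preordered by inclusion of their extents; this represents the subalgebra
-- of closed sets generated by the variables, and it lifts to all levels.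

open import Defs
open import Algebra.Definitions using (_DistributesOverˡ_)
open import Data.Product.Base using (_,_; proj₁; proj₂)
open import Data.Sum.Base using (inj₁; inj₂; [_,_]′)
open import Function.Bundles using (_⇔_; mk⇔; module Equivalence)
open import Level using (Level; Lift; lift; lower; 0ℓ)
open import Relation.Binary.Lattice.Bundles using (DistributiveLattice)
open import Relation.Binary.Lattice.Structures using (IsDistributiveLattice)
import Relation.Binary.Lattice.Properties.DistributiveLattice as DistributiveLatticeProperties
import Relation.Binary.Lattice.Properties.MeetSemilattice as MeetSemilatticeProperties
open import Relation.Binary.PropositionalEquality
  using (_≡_; refl; sym; cong; cong₂; subst; subst₂)
open import Relation.Unary using (Pred; _∈_; _⊆_; _≐_; _∩_; _∪_; ∅; U)

-- Soundness

module Residuation {c ℓ₁ ℓ₂} (𝔄 : BDRG c ℓ₁ ℓ₂) where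
  open BDRG 𝔄
    using (_≤_; residualʳ; residualˡ; x≤x∨y; y≤x∨y; ∨-least)
    renaming (refl to ≤-refl; trans to ≤-trans)
  private
    module A = BDRG 𝔄
    module Resʳ {a b c} = Equivalence (residualʳ a b c)
    module Resˡ {a b c} = Equivalence (residualˡ a b c)

  distributiveLattice : DistributiveLattice c ℓ₁ ℓ₂
  distributiveLattice = record { isDistributiveLattice = A.isDistributiveLattice }

  open DistributiveLattice distributiveLattice public
    using (meetSemilattice)
  open DistributiveLatticeProperties distributiveLattice public using (∧-distribʳ-∨)
  open MeetSemilatticeProperties meetSemilattice public using (∧-monotonic; ∧-comm; ∧-assoc)

  •-monotonic : ∀ {a b c d} → a ≤ b → c ≤ d → a A.• c ≤ b A.• d
  •-monotonic a≤b c≤d = ≤-trans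
    (Resˡ.from (≤-trans a≤b (Resˡ.to ≤-refl)))
    (Resʳ.from (≤-trans c≤d (Resʳ.to ≤-refl)))

  •-distribˡ-∨ : ∀ a b c → a A.• (b A.∨ c) ≤ a A.• b A.∨ a A.• c
  •-distribˡ-∨ a b c =
    Resʳ.from (∨-least (Resʳ.to (x≤x∨y _ _)) (Resʳ.to (y≤x∨y _ _)))

  •-distribʳ-∨ : ∀ a b c → (b A.∨ c) A.• a ≤ b A.• a A.∨ c A.• a
  •-distribʳ-∨ a b c =
    Resˡ.from (∨-least (Resˡ.to (x≤x∨y _ _)) (Resˡ.to (y≤x∨y _ _)))

  ⇒-eval : ∀ {a b} → a A.• (a A.⇒ b) ≤ b
  ⇒-eval = Resʳ.from ≤-refl

  ⇐-eval : ∀ {a b} → (b A.⇐ a) A.• a ≤ b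
  ⇐-eval = Resˡ.from ≤-refl

module Soundness {c ℓ₁ ℓ₂} (𝔄 : BDRG c ℓ₁ ℓ₂)
                 {Var : Set} (μ : Var → BDRG.Carrier 𝔄) where
  open BDRG 𝔄
    using (Carrier; _≤_; maximum; minimum; residualʳ; residualˡ; x≤x∨y; y≤x∨y
          ; ∨-least; x∧y≤x; x∧y≤y; ∧-greatest; ∧-distribˡ-∨; reflexive)
    renaming (refl to ≤-refl; trans to ≤-trans)
  open Residuation 𝔄
  private
    module A = BDRG 𝔄
    module Resʳ {a b c} = Equivalence (residualʳ a b c)
    module Resˡ {a b c} = Equivalence (residualˡ a b c)

  -- The element denoted by a structure, by way of its formula.
  value : Structure Var → Carrier
  value Γ = ⟦ 𝔄 ⟧ (τ Γ) μ

  context-monotonic : ∀ C {Γ Δ} → value Γ ≤ value Δ → value (C [ Γ ]) ≤ value (C [ Δ ])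
  context-monotonic □        p = p
  context-monotonic (C ⊙ˡ Σ) p = •-monotonic (context-monotonic C p) ≤-refl
  context-monotonic (C ⊼ˡ Σ) p = ∧-monotonic (context-monotonic C p) ≤-refl
  context-monotonic (Σ ⊙ʳ C) p = •-monotonic ≤-refl (context-monotonic C p)
  context-monotonic (Σ ⊼ʳ C) p = ∧-monotonic ≤-refl (context-monotonic C p)

  context-⊥ : ∀ C {a} → value (C [ ⟨ ⊥ ⟩ ]) ≤ a
  context-⊥ □        = minimum _
  context-⊥ (C ⊙ˡ Σ) = Resˡ.from (context-⊥ C)
  context-⊥ (C ⊼ˡ Σ) = ≤-trans (x∧y≤x _ _) (context-⊥ C)
  context-⊥ (Σ ⊙ʳ C) = Resʳ.from (context-⊥ C)
  context-⊥ (Σ ⊼ʳ C) = ≤-trans (x∧y≤y _ _) (context-⊥ C)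

  context-∨ : ∀ C {φ ψ} →
              value (C [ ⟨ φ ∨ ψ ⟩ ]) ≤ value (C [ ⟨ φ ⟩ ]) A.∨ value (C [ ⟨ ψ ⟩ ])
  context-∨ □        = ≤-refl
  context-∨ (C ⊙ˡ Σ) = ≤-trans (•-monotonic (context-∨ C) ≤-refl) (•-distribʳ-∨ _ _ _)
  context-∨ (C ⊼ˡ Σ) =
    ≤-trans (∧-monotonic (context-∨ C) ≤-refl) (reflexive (∧-distribʳ-∨ _ _ _))
  context-∨ (Σ ⊙ʳ C) = ≤-trans (•-monotonic ≤-refl (context-∨ C)) (•-distribˡ-∨ _ _ _)
  context-∨ (Σ ⊼ʳ C) =
    ≤-trans (∧-monotonic ≤-refl (context-∨ C)) (reflexive (∧-distribˡ-∨ _ _ _))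

  replace : ∀ C {Γ Δ a} → value Γ ≤ value Δ → value (C [ Δ ]) ≤ a → value (C [ Γ ]) ≤ a
  replace C p = ≤-trans (context-monotonic C p)

  sound : ∀ {Γ φ} → Γ ⊢ φ → Satisfies 𝔄 μ Γ φ
  sound id                  = ≤-refl
  sound ⊤R                  = maximum _
  sound (⊥L C)              = context-⊥ C
  sound (⇒L C d e)          = replace C (≤-trans (•-monotonic (sound d) ≤-refl) ⇒-eval) (sound e)
  sound (⇒R d)              = Resʳ.to (sound d)
  sound (⇐L C d e)          = replace C (≤-trans (•-monotonic ≤-refl (sound e)) ⇐-eval) (sound d)
  sound (⇐R d)              = Resˡ.to (sound d)
  sound (•L C d)            = replace C ≤-refl (sound d)
  sound (•R d e)            = •-monotonic (sound d) (sound e)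
  sound (∧L C d)            = replace C ≤-refl (sound d)
  sound (∧R d e)            = ∧-monotonic (sound d) (sound e)
  sound (∨L C d e)          = ≤-trans (context-∨ C) (∨-least (sound d) (sound e))
  sound (∨R₁ d)             = ≤-trans (sound d) (x≤x∨y _ _)
  sound (∨R₂ d)             = ≤-trans (sound d) (y≤x∨y _ _)
  sound (contraction C d)   = replace C (∧-greatest ≤-refl ≤-refl) (sound d)
  sound (weakening C d)     = replace C (x∧y≤y _ _) (sound d)
  sound (exchange C d)      = replace C (reflexive (∧-comm _ _)) (sound d)
  sound (associativity C d) = replace C (reflexive (A.Eq.sym (∧-assoc _ _ _))) (sound d)

-- Closed sets of structures

module _ {Var : Set} where

  StructureSet : Set₁
  StructureSet = Pred (Structure Var) 0ℓ

  infix 9 _⟪_⟫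

  -- Composition of contexts: D is put into the hole of C.
  _⟪_⟫ : Context Var → Context Var → Context Var
  □        ⟪ D ⟫ = D
  (C ⊙ˡ Γ) ⟪ D ⟫ = (C ⟪ D ⟫) ⊙ˡ Γ
  (C ⊼ˡ Γ) ⟪ D ⟫ = (C ⟪ D ⟫) ⊼ˡ Γ
  (Γ ⊙ʳ C) ⟪ D ⟫ = Γ ⊙ʳ (C ⟪ D ⟫)
  (Γ ⊼ʳ C) ⟪ D ⟫ = Γ ⊼ʳ (C ⟪ D ⟫)

  ⟪⟫-[] : ∀ C D {Γ} → (C ⟪ D ⟫) [ Γ ] ≡ C [ D [ Γ ] ]
  ⟪⟫-[] □        D = refl
  ⟪⟫-[] (C ⊙ˡ Γ) D = cong (_⊙ Γ) (⟪⟫-[] C D)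
  ⟪⟫-[] (C ⊼ˡ Γ) D = cong (_⊼ Γ) (⟪⟫-[] C D)
  ⟪⟫-[] (Γ ⊙ʳ C) D = cong (Γ ⊙_) (⟪⟫-[] C D)
  ⟪⟫-[] (Γ ⊼ʳ C) D = cong (Γ ⊼_) (⟪⟫-[] C D)

  -- Polar closure for the relation "C [ Γ ] ⊢ γ" between structures Γ and
  -- pairs (C , γ).
  cl : StructureSet → StructureSet
  cl P Γ = ∀ C γ → (∀ {Δ} → Δ ∈ P → C [ Δ ] ⊢ γ) → C [ Γ ] ⊢ γ

  -- Closed sets are the fixed points of cl; the other inclusion is cl-extensive.
  Closed : StructureSet → Set
  Closed P = cl P ⊆ P

  cl-extensive : ∀ {P} → P ⊆ cl P
  cl-extensive Γ∈P C γ derive = derive Γ∈P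

  cl-closed : ∀ P → Closed (cl P)
  cl-closed P Γ∈ C γ derive = Γ∈ C γ (λ Δ∈ → Δ∈ C γ derive)

  -- The closure is a nucleus for ⊙ and ⊼: it may be removed at any position
  -- inside a structure whose membership in a closed set is to be shown.
  cl-elim : ∀ {P Q} → Closed Q → ∀ D → (∀ {Δ} → Δ ∈ P → D [ Δ ] ∈ Q) →
            ∀ {Γ} → Γ ∈ cl P → D [ Γ ] ∈ Q
  cl-elim Q-closed D D[P]⊆Q Γ∈ = Q-closed λ C γ derive →
    subst (_⊢ γ) (⟪⟫-[] C D)
      (Γ∈ (C ⟪ D ⟫) γ λ Δ∈P → subst (_⊢ γ) (sym (⟪⟫-[] C D)) (derive (D[P]⊆Q Δ∈P)))

  cl-least : ∀ {P Q} → Closed Q → P ⊆ Q → cl P ⊆ Q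
  cl-least Q-closed P⊆Q = cl-elim Q-closed □ P⊆Q

  closed-weakenˡ : ∀ {P} → Closed P → ∀ {Γ Δ} → Δ ∈ P → Γ ⊼ Δ ∈ P
  closed-weakenˡ P-closed Δ∈P = P-closed λ C γ derive → weakening C (derive Δ∈P)

  closed-weakenʳ : ∀ {P} → Closed P → ∀ {Γ Δ} → Γ ∈ P → Γ ⊼ Δ ∈ P
  closed-weakenʳ P-closed Γ∈P =
    P-closed λ C γ derive → exchange C (weakening C (derive Γ∈P))

  closed-contract : ∀ {P} → Closed P → ∀ {Γ} → Γ ⊼ Γ ∈ P → Γ ∈ P
  closed-contract P-closed ΓΓ∈P = P-closed λ C γ derive → contraction C (derive ΓΓ∈P)

  -- Elementwise product of sets along ⊙.
  data _⊛_ (P Q : StructureSet) : StructureSet where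
    _⊙_ : ∀ {Γ Δ} → Γ ∈ P → Δ ∈ Q → Γ ⊙ Δ ∈ P ⊛ Q

  -- Residuals of ⊛.  They are closed when their numerator is, by cl-elim with
  -- a context that supplies the other factor.
  _⇛_ : StructureSet → StructureSet → StructureSet
  (P ⇛ Q) Γ = ∀ {Δ} → Δ ∈ P → Δ ⊙ Γ ∈ Q

  _⇚_ : StructureSet → StructureSet → StructureSet
  (Q ⇚ P) Γ = ∀ {Δ} → Δ ∈ P → Γ ⊙ Δ ∈ Q

  ∩-distribˡ-cl∪ : ∀ {P Q R} → Closed P → Closed Q → Closed R →
                   P ∩ cl (Q ∪ R) ⊆ cl ((P ∩ Q) ∪ (P ∩ R))
  ∩-distribˡ-cl∪ {P} {Q} {R} P-closed Q-closed R-closed {Γ} (Γ∈P , Γ∈Q∨R) =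
    -- One copy of Γ supplies membership in P, the other the case distinction.
    closed-contract (cl-closed _) (cl-elim (cl-closed _) (Γ ⊼ʳ □) cases Γ∈Q∨R)
    where
    cases : ∀ {Δ} → Δ ∈ Q ∪ R → Γ ⊼ Δ ∈ cl ((P ∩ Q) ∪ (P ∩ R))
    cases (inj₁ Δ∈Q) =
      cl-extensive (inj₁ (closed-weakenʳ P-closed Γ∈P , closed-weakenˡ Q-closed Δ∈Q))
    cases (inj₂ Δ∈R) =
      cl-extensive (inj₂ (closed-weakenʳ P-closed Γ∈P , closed-weakenˡ R-closed Δ∈R))

-- The truth lemma

  -- The closed set of structures interpreting a formula.
  Ext : Formula Var → StructureSet
  Ext (var p) Γ = Γ ⊢ var p
  Ext ⊤         = U
  Ext ⊥         = cl ∅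
  Ext (φ ∧ ψ)   = Ext φ ∩ Ext ψ
  Ext (φ ∨ ψ)   = cl (Ext φ ∪ Ext ψ)
  Ext (φ ⇒ ψ)   = Ext φ ⇛ Ext ψ
  Ext (φ • ψ)   = cl (Ext φ ⊛ Ext ψ)
  Ext (φ ⇐ ψ)   = Ext φ ⇚ Ext ψ

  Ext-closed : ∀ φ → Closed (Ext φ)
  Ext-closed (var p) Γ∈ = Γ∈ □ (var p) (λ d → d)
  Ext-closed ⊤       _  = _
  Ext-closed ⊥          = cl-closed ∅
  Ext-closed (φ ∧ ψ) Γ∈ = cl-least (Ext-closed φ) proj₁ Γ∈ , cl-least (Ext-closed ψ) proj₂ Γ∈
  Ext-closed (φ ∨ ψ)    = cl-closed (Ext φ ∪ Ext ψ)
  Ext-closed (φ ⇒ ψ) Γ∈ {Δ} Δ∈ = cl-elim (Ext-closed ψ) (Δ ⊙ʳ □) (λ f → f Δ∈) Γ∈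
  Ext-closed (φ • ψ)    = cl-closed (Ext φ ⊛ Ext ψ)
  Ext-closed (φ ⇐ ψ) Γ∈ {Δ} Δ∈ = cl-elim (Ext-closed φ) (□ ⊙ˡ Δ) (λ f → f Δ∈) Γ∈

  -- The truth lemma.  Its two halves are proved together, since the residuals
  -- reverse inclusion in their denominators.
  mutual
    formula∈Ext : ∀ φ → ⟨ φ ⟩ ∈ Ext φ
    formula∈Ext (var p) = id
    formula∈Ext ⊤       = _
    formula∈Ext ⊥       = λ C γ _ → ⊥L C
    formula∈Ext (φ ∧ ψ) =
        Ext-closed φ (λ C γ derive →
          ∧L C (derive (closed-weakenʳ (Ext-closed φ) (formula∈Ext φ))))
      , Ext-closed ψ (λ C γ derive →
          ∧L C (derive (closed-weakenˡ (Ext-closed ψ) (formula∈Ext ψ))))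
    formula∈Ext (φ ∨ ψ) = λ C γ derive →
      ∨L C (derive (inj₁ (formula∈Ext φ))) (derive (inj₂ (formula∈Ext ψ)))
    formula∈Ext (φ ⇒ ψ) = λ Δ∈ → Ext-closed ψ λ C γ derive →
      ⇒L C (Ext⇒⊢ φ Δ∈) (derive (formula∈Ext ψ))
    formula∈Ext (φ • ψ) = λ C γ derive → •L C (derive (formula∈Ext φ ⊙ formula∈Ext ψ))
    formula∈Ext (φ ⇐ ψ) = λ Δ∈ → Ext-closed φ λ C γ derive →
      ⇐L C (derive (formula∈Ext φ)) (Ext⇒⊢ ψ Δ∈)

    Ext⇒⊢ : ∀ φ {Γ} → Γ ∈ Ext φ → Γ ⊢ φ
    Ext⇒⊢ (var p) d         = d
    Ext⇒⊢ ⊤       _         = ⊤R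
    Ext⇒⊢ ⊥       Γ∈        = Γ∈ □ ⊥ λ ()
    Ext⇒⊢ (φ ∧ ψ) (Γ∈ , Γ∈′) =
      contraction □ (∧R (Ext⇒⊢ φ Γ∈) (Ext⇒⊢ ψ Γ∈′))
    Ext⇒⊢ (φ ∨ ψ) Γ∈        =
      Γ∈ □ (φ ∨ ψ) [ (λ Δ∈ → ∨R₁ (Ext⇒⊢ φ Δ∈)) , (λ Δ∈ → ∨R₂ (Ext⇒⊢ ψ Δ∈)) ]′
    Ext⇒⊢ (φ ⇒ ψ) Γ∈        = ⇒R (Ext⇒⊢ ψ (Γ∈ (formula∈Ext φ)))
    Ext⇒⊢ (φ • ψ) Γ∈        =
      Γ∈ □ (φ • ψ) λ { (Δ∈ ⊙ Λ∈) → •R (Ext⇒⊢ φ Δ∈) (Ext⇒⊢ ψ Λ∈) }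
    Ext⇒⊢ (φ ⇐ ψ) Γ∈        = ⇐R (Ext⇒⊢ φ (Γ∈ (formula∈Ext ψ)))

  structure∈Ext : ∀ Γ → Γ ∈ Ext (τ Γ)
  structure∈Ext ⟨ φ ⟩   = formula∈Ext φ
  structure∈Ext (Γ ⊙ Δ) = cl-extensive (structure∈Ext Γ ⊙ structure∈Ext Δ)
  structure∈Ext (Γ ⊼ Δ) =
      closed-weakenʳ (Ext-closed (τ Γ)) (structure∈Ext Γ)
    , closed-weakenˡ (Ext-closed (τ Δ)) (structure∈Ext Δ)

-- The algebra of extents

-- Its elements are formulas, lifted to level c and ordered by inclusion of
-- extents; its operations are the connectives.
module ExtentAlgebra (c ℓ₁ ℓ₂ : Level) (Var : Set) where

  Carrier : Set c
  Carrier = Lift c (Formula Var)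

  _≈_ : Carrier → Carrier → Set ℓ₁
  lift φ ≈ lift ψ = Lift ℓ₁ (Ext φ ≐ Ext ψ)

  _≤_ : Carrier → Carrier → Set ℓ₂
  lift φ ≤ lift ψ = Lift ℓ₂ (Ext φ ⊆ Ext ψ)

  liftOp : (Formula Var → Formula Var → Formula Var) → Carrier → Carrier → Carrier
  liftOp _∙_ (lift φ) (lift ψ) = lift (φ ∙ ψ)

  ∧-distribˡ-∨ : _DistributesOverˡ_ _≈_ (liftOp _∧_) (liftOp _∨_)
  ∧-distribˡ-∨ (lift φ) (lift ψ) (lift χ) = lift
    ( ∩-distribˡ-cl∪ (Ext-closed φ) (Ext-closed ψ) (Ext-closed χ)
    , cl-least (Ext-closed (φ ∧ (ψ ∨ χ)))
        [ (λ (Γ∈φ , Γ∈ψ) → Γ∈φ , cl-extensive (inj₁ Γ∈ψ))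
        , (λ (Γ∈φ , Γ∈χ) → Γ∈φ , cl-extensive (inj₂ Γ∈χ)) ]′ )

  isDistributiveLattice : IsDistributiveLattice _≈_ _≤_ (liftOp _∨_) (liftOp _∧_)
  isDistributiveLattice = record
    { isLattice = record
      { isPartialOrder = record
        { isPreorder = record
          { isEquivalence = record
            { refl  = lift ((λ x → x) , (λ x → x))
            ; sym   = λ (lift (f , g)) → lift (g , f)
            ; trans = λ (lift (f , g)) (lift (h , k)) → lift ((λ x → h (f x)) , (λ x → g (k x)))
            }
          ; reflexive = λ (lift (f , _)) → lift f
          ; trans     = λ (lift f) (lift g) → lift (λ x → g (f x))
          }
        ; antisym = λ (lift f) (lift g) → lift (f , g)
        }
      ; supremum = λ (lift φ) (lift ψ) →
            lift (λ x → cl-extensive (inj₁ x))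
          , lift (λ x → cl-extensive (inj₂ x))
          , λ (lift χ) (lift f) (lift g) → lift (cl-least (Ext-closed χ) [ f , g ]′)
      ; infimum = λ _ _ →
            lift proj₁
          , lift proj₂
          , λ _ (lift f) (lift g) → lift (λ x → f x , g x)
      }
    ; ∧-distribˡ-∨ = ∧-distribˡ-∨
    }

  algebra : BDRG c ℓ₁ ℓ₂
  algebra = record
    { Carrier = Carrier
    ; _≈_     = _≈_
    ; _≤_     = _≤_
    ; _∧_     = liftOp _∧_
    ; _∨_     = liftOp _∨_
    ; ⊤       = lift ⊤
    ; ⊥       = lift ⊥
    ; _⇒_     = liftOp _⇒_
    ; _•_     = liftOp _•_
    ; _⇐_     = liftOp _⇐_
    ; isDistributiveLattice = isDistributiveLattice
    ; maximum   = λ _ → lift _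
    ; minimum   = λ (lift φ) → lift (cl-least (Ext-closed φ) λ ())
    ; residualʳ = λ (lift φ) (lift ψ) (lift χ) → mk⇔
        (λ (lift f) → lift λ y x → f (cl-extensive (x ⊙ y)))
        (λ (lift f) → lift (cl-least (Ext-closed χ) λ { (x ⊙ y) → f y x }))
    ; residualˡ = λ (lift φ) (lift ψ) (lift χ) → mk⇔
        (λ (lift f) → lift λ x y → f (cl-extensive (x ⊙ y)))
        (λ (lift f) → lift (cl-least (Ext-closed χ) λ { (x ⊙ y) → f x y }))
    }

  assignment : Var → Carrier
  assignment p = lift (var p)

  -- Every formula denotes itself under this assignment.
  interpretation : ∀ φ → lower (⟦ algebra ⟧ φ assignment) ≡ φ
  interpretation (var p) = refl
  interpretation ⊤       = refl
  interpretation ⊥       = refl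
  interpretation (φ ∧ ψ) = cong₂ _∧_ (interpretation φ) (interpretation ψ)
  interpretation (φ ∨ ψ) = cong₂ _∨_ (interpretation φ) (interpretation ψ)
  interpretation (φ ⇒ ψ) = cong₂ _⇒_ (interpretation φ) (interpretation ψ)
  interpretation (φ • ψ) = cong₂ _•_ (interpretation φ) (interpretation ψ)
  interpretation (φ ⇐ ψ) = cong₂ _⇐_ (interpretation φ) (interpretation ψ)

  complete : ∀ {Γ φ} → Satisfies algebra assignment Γ φ → Γ ⊢ φ
  complete {Γ} {φ} (lift inclusion) = Ext⇒⊢ φ
    (subst₂ (λ χ ψ → Ext χ ⊆ Ext ψ) (interpretation (τ Γ)) (interpretation φ) inclusion
      (structure∈Ext Γ))

theorem12 : ∀ (c ℓ₁ ℓ₂ : Level) {Var : Set} (Γ : Structure Var) (φ : Formula Var) → (Γ ⊢ φ) ⇔ BDRG⊨ c ℓ₁ ℓ₂ Γ φ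
theorem12 c ℓ₁ ℓ₂ {Var} Γ φ = mk⇔
  (λ d 𝔄 μ → Soundness.sound 𝔄 μ d)
  (λ valid → complete (valid algebra assignment))
  where open ExtentAlgebra c ℓ₁ ℓ₂ Var
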